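{- For any integer $n \geq 0$ (with $a$ denoting a nonnegative integer), $$v_2(B_n(3,2)) = \begin{cases} 1, & \text{if } n \equiv 4 \pmod{8}, \\ 3, & \text{if } n \equiv 8 \pmod{16}, \\ 1 + v_2 \big( a(a+1) \big), & \text{if } n=4a+1 \text{ and } v_2\big( a(a+1) \big) \leq 4, \\ 0, & \text{if } n \equiv 2 \pmod{4}, \\ 0, & \text{if } n \equiv 3 \pmod{4}. \end{cases}$$ (No assertion is made for values of $n$ not covered by these cases.)
   Context: The sequence $\{B_n(3,2)\}_{n\geq 0}$ is defined by $B_n = B_{n-1}+B_{n-2}+B_{n-3}$ for $n \geq 3$, with $(B_0,B_1,B_2)=(0,0,1)$. $v_2$ denotes the 2-adic order (2-adic valuation), with the convention $v_2(0)=+\infty$. -}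

module Defs where

open import Data.Bool.Base using (if_then_else_)
open import Data.Maybe.Base using (map)
open import Data.Nat.Base using (ℕ; zero; suc; _+_; _^_; _≤_; _<_; z≤n; s≤s; s≤s⁻¹)
open import Data.Nat.Divisibility using (_∣_; _∣?_; 1∣_; ∣⇒≤)
open import Data.Nat.Properties using (≤-trans; ≤-refl; <⇒≤; m≤n⇒m<n∨m≡n; +-monoˡ-≤; +-monoʳ-≤; m≤m+n; m^n>0)
open import Data.Sum.Base using (inj₁; inj₂)
open import Relation.Binary.PropositionalEquality using (_≡_; refl)
open import Relation.Nullary using (yes; no; does; contradiction)
open import Relation.Nullary.Construct.Add.Supremum using (_⁺; ⊤⁺; [_])
import Relation.Binary.Construct.Add.Supremum.NonStrict as Supremum

open Supremum _≤_ using (_≤⁺_) public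

B : ℕ → ℕ
B 0 = 0
B 1 = 0
B 2 = 1
B (suc (suc (suc n))) = B (suc (suc n)) + B (suc n) + B n

-- The largest k ≤ b such that 2 ^ k ∣ n.
greatest : (b n : ℕ) → ℕ
greatest zero    n = zero
greatest (suc b) n = if does (2 ^ suc b ∣? n) then suc b else greatest b n

-- 2-adic order, with ⊤⁺ as +∞. Bounding the search by n loses nothing for
-- n > 0, since 2 ^ k ∣ n forces k < 2 ^ k ≤ n; see v₂-divides and v₂-largest.
v₂ : ℕ → ℕ ⁺
v₂ zero      = ⊤⁺
v₂ n@(suc _) = [ greatest n n ]

infixl 6 _+⁺_

_+⁺_ : ℕ → ℕ ⁺ → ℕ ⁺
k +⁺ x = map (k +_) x

greatest-∣ : ∀ b n → 2 ^ greatest b n ∣ n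
greatest-∣ zero    n = 1∣ n
greatest-∣ (suc b) n with 2 ^ suc b ∣? n
... | yes d = d
... | no  _ = greatest-∣ b n

greatest-max : ∀ b n {k} → k ≤ b → 2 ^ k ∣ n → k ≤ greatest b n
greatest-max zero    n k≤b d = k≤b
greatest-max (suc b) n k≤b d with 2 ^ suc b ∣? n
... | yes _ = k≤b
... | no ¬d with m≤n⇒m<n∨m≡n k≤b
...   | inj₁ k<1+b = greatest-max b n (s≤s⁻¹ k<1+b) d
...   | inj₂ refl  = contradiction d ¬d

k<2^k : ∀ k → k < 2 ^ k
k<2^k zero    = ≤-refl
k<2^k (suc k) = ≤-trans (s≤s (k<2^k k))
  (≤-trans (+-monoˡ-≤ (2 ^ k) (m^n>0 2 k)) (+-monoʳ-≤ (2 ^ k) (m≤m+n (2 ^ k) 0)))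

v₂-divides : ∀ n {k} → v₂ n ≡ [ k ] → 2 ^ k ∣ n
v₂-divides n@(suc _) refl = greatest-∣ n n

v₂-largest : ∀ n {k j} → v₂ n ≡ [ k ] → 2 ^ j ∣ n → j ≤ k
v₂-largest n@(suc _) {j = j} refl d =
  greatest-max n n (≤-trans (<⇒≤ (k<2^k j)) (∣⇒≤ d)) d

{-# OPTIONS --safe #-}
module Submission where

-- Every asserted value of v₂ (B n) is at most 5, so it is determined by
-- B n mod 64. The sequence B mod 64 has period 128, and v₂ (a * (a + 1)) ≤ 4 is
-- determined by a mod 32, i.e. by 4 * a + 1 mod 128: finitely many residues remain.

open import Defs
open import Data.Nat.Base using (ℕ; zero; suc; _+_; _*_; _^_; _/_; _%_; _≤_; _<_; z≤n; s≤s; NonZero)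
open import Data.Nat.Divisibility
  using (_∣_; divides; ∣-trans; 1∣_; *-monoʳ-∣; ∣n∣m%n⇒∣m; %-presˡ-∣; _∣0)
open import Data.Nat.DivMod
  using (m≡m%n+[m/n]*n; m%n<n; m%n%n≡m%n; %-distribˡ-+; [m+kn]%n≡m%n; m∣n⇒o%n%m≡o%m)
open import Data.Nat.GeneralisedArithmetic using (fold; fold-+)
open import Data.Nat.Properties
  using (<⇒≤; ≤-antisym; <-irrefl; _≟_; ≮⇒≥; _<?_; _≤?_; allUpTo?)
open import Data.Nat.Tactic.RingSolver using (solve-∀)
open import Data.Product.Base using (_×_; _,_; proj₁)
open import Relation.Binary.PropositionalEquality
  using (_≡_; refl; sym; trans; cong; cong₂; subst; module ≡-Reasoning)
open import Relation.Nullary.Construct.Add.Supremum using ([_]; ≡-dec)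
open import Relation.Nullary.Decidable using (True; toWitness; _→-dec_)
open import Relation.Nullary using (yes; no; ¬_; contradiction)
import Relation.Binary.Construct.Add.Supremum.NonStrict as Supremum

m≤n⇒o^m∣o^n : ∀ o {m n} → m ≤ n → o ^ m ∣ o ^ n
m≤n⇒o^m∣o^n o z≤n       = 1∣ _
m≤n⇒o^m∣o^n o (s≤s m≤n) = *-monoʳ-∣ o (m≤n⇒o^m∣o^n o m≤n)

v₂-unique : ∀ m {k} → 2 ^ k ∣ m → ¬ 2 ^ suc k ∣ m → v₂ m ≡ [ k ]
-- Every power of 2 divides 0, so the second hypothesis already excludes the argument at which `v₂`
-- is infinite.
v₂-unique zero        _ ¬d = contradiction (_ ∣0) ¬d
v₂-unique m@(suc _) {k} d ¬d = cong [_] (≤-antisym upper (v₂-largest m refl d))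
  where
  upper : greatest m m ≤ k
  upper with k <? greatest m m
  ... | yes k<g = contradiction
    (∣-trans (m≤n⇒o^m∣o^n 2 k<g) (v₂-divides m refl)) ¬d
  ... | no  k≮g = ≮⇒≥ k≮g

∣-cong-% : ∀ {d m m′ n} .{{_ : NonZero n}} →
           d ∣ n → m % n ≡ m′ % n → d ∣ m → d ∣ m′
∣-cong-% {d} d∣n eq d∣m = ∣n∣m%n⇒∣m d∣n (subst (d ∣_) eq (%-presˡ-∣ d∣m d∣n))

-- As `k < K`, both `2 ^ k` and `2 ^ suc k` divide `2 ^ K`, so divisibility by either depends only
-- on the residue.
v₂-cong-% : ∀ K {m m′ k} .{{_ : NonZero (2 ^ K)}} →
            m % 2 ^ K ≡ m′ % 2 ^ K → k < K → v₂ m ≡ [ k ] → v₂ m′ ≡ [ k ]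
v₂-cong-% K {m} {m′} eq k<K vm = v₂-unique m′
  (∣-cong-% (m≤n⇒o^m∣o^n 2 (<⇒≤ k<K)) eq (v₂-divides m vm))
  (λ d → <-irrefl refl (v₂-largest m vm (∣-cong-% (m≤n⇒o^m∣o^n 2 k<K) (sym eq) d)))

-- Three consecutive terms mod 64 form a complete state of the recurrence, so a single return to the
-- initial state gives periodicity. Reducing at each shift keeps evaluation cheap.
Window : Set
Window = ℕ × ℕ × ℕ

shift : Window → Window
shift (x , y , z) = y , z , (z + y + x) % 64

window : ℕ → Window
window = fold (0 , 0 , 1) shift

%-distribˡ-+₃ : ∀ x y z d .{{_ : NonZero d}} →
                (x % d + y % d + z % d) % d ≡ (x + y + z) % d
%-distribˡ-+₃ x y z d = begin
  (x % d + y % d + z % d) % d             ≡⟨ %-distribˡ-+ (x % d + y % d) (z % d) d ⟩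
  ((x % d + y % d) % d + z % d % d) % d   ≡⟨ cong₂ (λ s t → (s + t) % d) (sym (%-distribˡ-+ x y d)) (m%n%n≡m%n z d) ⟩
  ((x + y) % d + z % d) % d               ≡⟨ sym (%-distribˡ-+ (x + y) z d) ⟩
  (x + y + z) % d                         ∎
  where open ≡-Reasoning

window-B : ∀ n → window n ≡ (B n % 64 , B (1 + n) % 64 , B (2 + n) % 64)
window-B zero    = refl
window-B (suc n) = trans (cong shift (window-B n))
  (cong (λ t → B (1 + n) % 64 , B (2 + n) % 64 , t)
    (%-distribˡ-+₃ (B (2 + n)) (B (1 + n)) (B n) 64))

fold-period : ∀ {A : Set} (z : A) (s : A → A) p → fold z s p ≡ z →
              ∀ r q → fold z s (r + q * p) ≡ fold z s r
fold-period z s p eq r q = trans (fold-+ z s r) (cong (λ w → fold w s r) (cycles q))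
  where
  cycles : ∀ q → fold z s (q * p) ≡ z
  cycles zero    = refl
  cycles (suc q) = trans (fold-+ z s p) (trans (cong (λ w → fold w s p) (cycles q)) eq)

-- The `refl` runs 128 shifts and checks that the state is again `(0 , 0 , 1)`.
window-periodic : ∀ r q → window (r + q * 128) ≡ window r
window-periodic = fold-period (0 , 0 , 1) shift 128 refl

residue : ℕ → ℕ
residue n = proj₁ (window n)

residue-B : ∀ r q → residue r % 64 ≡ B (r + q * 128) % 64
residue-B r q = begin
  residue r % 64               ≡⟨ cong (λ w → proj₁ w % 64) (sym (window-periodic r q)) ⟩
  residue (r + q * 128) % 64   ≡⟨ cong (λ w → proj₁ w % 64) (window-B (r + q * 128)) ⟩
  B (r + q * 128) % 64 % 64    ≡⟨ m%n%n≡m%n (B (r + q * 128)) 64 ⟩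
  B (r + q * 128) % 64         ∎
  where open ≡-Reasoning

-- Since `m ∣ 128`, the class of `n` mod `m` can be read off `n % 128`. The implicit `True` argument
-- is found by evaluating the decision over all 128 residues at each use.
v₂-B-on-class : ∀ m c k .{{_ : NonZero m}} → m ∣ 128 → k < 6 →
  {True (allUpTo? (λ r → (r % m ≟ c) →-dec ≡-dec _≟_ (v₂ (residue r)) [ k ]) 128)} →
  ∀ n → n % m ≡ c → v₂ (B n) ≡ [ k ]
v₂-B-on-class m c k m∣128 k<6 {check} n n%m≡c =
  subst (λ x → v₂ (B x) ≡ [ k ]) (sym (m≡m%n+[m/n]*n n 128))
    (v₂-cong-% 6 (residue-B (n % 128) (n / 128)) k<6
      (toWitness check (m%n<n n 128) (trans (m∣n⇒o%n%m≡o%m m 128 n m∣128) n%m≡c)))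

-- Checked by evaluation for all 32 values. The bound discards `i = 0` (infinite order) and `i = 31`
-- (order 5).
v₂-residue-4i+1 : ∀ {i} → i < 32 → v₂ (i * (i + 1)) ≤⁺ [ 4 ] →
                  v₂ (residue (4 * i + 1)) ≡ 1 +⁺ v₂ (i * (i + 1))
v₂-residue-4i+1 = toWitness {a? = allUpTo? (λ i →
  Supremum.≤⁺-dec _≤_ _≤?_ (v₂ (i * (i + 1))) [ 4 ] →-dec
  ≡-dec _≟_ (v₂ (residue (4 * i + 1))) (1 +⁺ v₂ (i * (i + 1)))) 32} _

v₂-B-4[i+32q]+1 : ∀ i q → i < 32 → let a = i + q * 32 in
  v₂ (a * (a + 1)) ≤⁺ [ 4 ] → v₂ (B (4 * a + 1)) ≡ 1 +⁺ v₂ (a * (a + 1))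
v₂-B-4[i+32q]+1 i q i<32 v≤4
  with v₂ ((i + q * 32) * (i + q * 32 + 1)) in v≡k | v≤4
-- The bound by `[ 4 ]` leaves only finite orders.
... | [ k ] | Supremum.[ k≤4 ] =
  subst (λ x → v₂ (B x) ≡ [ suc k ]) (sym (4a+1 i q))
    -- The order to transfer is `suc k`, at most 5, hence visible mod 64.
    (v₂-cong-% 6 (residue-B (4 * i + 1) q) (s≤s (s≤s k≤4))
      (trans (v₂-residue-4i+1 i<32 (subst (_≤⁺ [ 4 ]) (sym vᵢ) Supremum.[ k≤4 ]))
             (cong (1 +⁺_) vᵢ)))
  where
  4a+1 : ∀ i q → 4 * (i + q * 32) + 1 ≡ 4 * i + 1 + q * 128
  4a+1 = solve-∀

  -- With `a = i + q * 32`, the difference of the two products factors as `(a - i) * (a + i + 1)`.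
  a[a+1] : ∀ i q → (i + q * 32) * (i + q * 32 + 1) ≡
                   i * (i + 1) + (q * (2 * i + 1 + q * 32)) * 32
  a[a+1] = solve-∀

  -- Here the order is `k`, at most 4, so agreement mod 32 suffices.
  vᵢ : v₂ (i * (i + 1)) ≡ [ k ]
  vᵢ = v₂-cong-% 5 (trans (cong (_% 32) (a[a+1] i q))
                          ([m+kn]%n≡m%n (i * (i + 1)) (q * (2 * i + 1 + q * 32)) 32)) (s≤s k≤4) v≡k

theorem12 : (n : ℕ) →
    (n % 8 ≡ 4 → v₂ (B n) ≡ [ 1 ])
    × (n % 16 ≡ 8 → v₂ (B n) ≡ [ 3 ])
    × ((a : ℕ) → n ≡ 4 * a + 1 → v₂ (a * (a + 1)) ≤⁺ [ 4 ] →
    v₂ (B n) ≡ 1 +⁺ v₂ (a * (a + 1)))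
    × (n % 4 ≡ 2 → v₂ (B n) ≡ [ 0 ])
    × (n % 4 ≡ 3 → v₂ (B n) ≡ [ 0 ])
theorem12 n =
    v₂-B-on-class 8 4 1 (divides 16 refl) (s≤s (s≤s z≤n)) n
  , v₂-B-on-class 16 8 3 (divides 8 refl) (s≤s (s≤s (s≤s (s≤s z≤n)))) n
  , (λ where
      a refl → subst (λ a → v₂ (a * (a + 1)) ≤⁺ [ 4 ] →
                            v₂ (B (4 * a + 1)) ≡ 1 +⁺ v₂ (a * (a + 1)))
        (sym (m≡m%n+[m/n]*n a 32))
        (v₂-B-4[i+32q]+1 (a % 32) (a / 32) (m%n<n a 32)))
  , v₂-B-on-class 4 2 0 (divides 32 refl) (s≤s z≤n) n
  , v₂-B-on-class 4 3 0 (divides 32 refl) (s≤s z≤n) n
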